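{- Let $k$ be a positive integer and let $\mathbb{F}_q$ be the finite field with $q$ elements. If $q>k^4$, then every element of $\mathbb{F}_q$ can be written as a sum of two $k$-th powers of elements of $\mathbb{F}_q$.
   Context: The element $0=0^k$ counts as a $k$-th power. -}

module Defs where

open import Algebra.Apartness.Bundles using (HeytingField; HeytingCommutativeRing)
open import Algebra.Bundles using (CommutativeRing)
open import Data.Fin.Base using (Fin)
open import Data.Nat.Base using (ℕ)
open import Data.Product.Base using (∃-syntax)
open import Function.Bundles using (Inverse)
open import Level using (Level; _⊔_)
import Algebra.Properties.Semiring.Exp as Exp
import Relation.Binary.PropositionalEquality as ≡

module _ {c ℓ₁ ℓ₂ : Level} (F : HeytingField c ℓ₁ ℓ₂) where

  private
    commutativeRing : CommutativeRing c ℓ₁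
    commutativeRing =
      HeytingCommutativeRing.commutativeRing (HeytingField.heytingCommutativeRing F)

  open CommutativeRing commutativeRing using (Carrier; _≈_; _+_; setoid; semiring)
  open Exp semiring using (_^_)

  -- The elements of F up to _≈_ are in bijection with Fin q. This makes _≈_
  -- decidable, and hence (invertibility being decidable by finite search)
  -- the apartness of F coincides with inequality: a Heyting field of
  -- order q is the same thing as a field with q elements in the usual sense,
  -- with 1# ≉ 0# and every x ≉ 0# invertible.
  HasOrder : ℕ → Set (c ⊔ ℓ₁)
  HasOrder q = Inverse setoid (≡.setoid (Fin q))

  -- x and y are arbitrary, so 0# = 0# ^ k is allowed as a summand.
  IsSumOfTwoPowers : ℕ → Carrier → Set (c ⊔ ℓ₁)
  IsSumOfTwoPowers k a = ∃[ x ] ∃[ y ] a ≈ x ^ k + y ^ k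

{-# OPTIONS --safe #-}

-- Let A be the set of k-th powers (0 included), n = |A|, and g = q·1_A − n,
-- which sums to 0. Expanding the square,
--   Σ_{t,x} (Σ_y g(x + ty) g(−y))² = q (Σ g²)²,
-- because for y ≠ z the map (t, x) ↦ (x + ty, x + tz) is a bijection of F², so
-- that the off-diagonal terms vanish. If a ≠ 0 is not a sum of two k-th powers,
-- then the inner sum equals −q n² for all t ∈ A \ {0} and x ∈ a(A \ {0}), which
-- bounds the left side below by (n − 1)² q² n⁴, while Σ g² = q n (q − n). Since
-- x ↦ x^k has fibres of size at most k, q − 1 ≤ k (n − 1), and hence q ≤ k⁴.

module Submission where

open import Defs
open import Algebra.Apartness.Bundles using (HeytingField)
open import Data.Nat.Base using (ℕ; NonZero; _^_; _>_)
open import Level using (Level)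

open import Algebra.Apartness.Bundles using (HeytingCommutativeRing)
import Algebra.Apartness.Properties.HeytingCommutativeRing as HeytingProperties
open import Algebra.Bundles using (CommutativeRing; RawRing)
open import Algebra.Core using (Op₁; Op₂)
import Algebra.Morphism.RingMonomorphism as RingMonomorphism
open import Algebra.Morphism.Structures using (IsRingMonomorphism)
import Algebra.Properties.CommutativeSemiring.Exp as CommutativeExp
import Algebra.Properties.Group as GroupProperties
import Algebra.Properties.Ring as RingProperties
import Algebra.Properties.Semiring.Exp as Exp
import Algebra.Properties.Semiring.Sum as Sum
import Algebra.Solver.Ring.NaturalCoefficients.Default as NaturalSolver
open import Algebra.Structures using (IsCommutativeRing)
open import Data.Bool.Base using (if_then_else_)
open import Data.Fin.Base using (Fin; zero; suc)
open import Data.Fin.Permutation using (permutation)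
open import Data.Fin.Properties using (_≟_; any?)
open import Data.Integer.Base as ℤ using (ℤ; +_; -[1+_]; 0ℤ; 1ℤ; _+_; _-_; _*_; -_; _≤_; +≤+)
open import Data.Integer.Properties as ℤₚ using (≤-refl; ≤-trans; ≤-reflexive; +-*-semiring)
open import Data.Integer.Tactic.RingSolver using (solve-∀)
import Data.Nat.Base as ℕ
import Data.Nat.Properties as ℕₚ
import Data.Nat.Tactic.RingSolver as ℕ-Solver
open import Data.Product.Base using (∃-syntax; _×_; _,_; proj₁; proj₂)
open import Data.Sum.Base using (_⊎_; inj₁; inj₂)
open import Data.Vec.Base using (Vec; []; _∷_; replicate)
open import Function.Base using (_∘_)
open import Function.Bundles using (Inverse)
open import Level using (0ℓ)
open import Relation.Binary.PropositionalEquality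
import Relation.Binary.Reasoning.Setoid as ≈-Reasoning
open import Relation.Nullary using (Dec; yes; no; does; ¬_; contradiction)
open import Relation.Nullary.Decidable using (¬?; _×-dec_)

open Sum +-*-semiring using (sum-syntax; sum-cong-≗; ∑-distrib-+; ∑-comm; ∑-permute;
  *-distribˡ-sum; *-distribʳ-sum; sum-replicate-zero)

private variable
  P Q R : Set

-- Finite sums of integers.

∑-mono : ∀ {n} {f g : Fin n → ℤ} → (∀ i → f i ≤ g i) → ∑[ i < n ] f i ≤ ∑[ i < n ] g i
∑-mono {ℕ.zero}  f≤g = ≤-refl
∑-mono {ℕ.suc n} f≤g = ℤₚ.+-mono-≤ (f≤g zero) (∑-mono (f≤g ∘ suc))

∑-const : ∀ n c → ∑[ i < n ] c ≡ + n * c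
∑-const ℕ.zero    c = refl
∑-const (ℕ.suc n) c = trans (cong (λ s → c + s) (∑-const n c)) (sym (ℤₚ.suc-* (+ n) c))

∑-zero : ∀ {n} {f : Fin n → ℤ} → (∀ i → f i ≡ 0ℤ) → ∑[ i < n ] f i ≡ 0ℤ
∑-zero {n} f≡0 = trans (sum-cong-≗ f≡0) (sum-replicate-zero n)

sum-squared : ∀ {n} (f : Fin n → ℤ) →
  ∑[ i < n ] f i * ∑[ i < n ] f i ≡ ∑[ i < n ] ∑[ j < n ] (f i * f j)
sum-squared {n} f = trans (*-distribʳ-sum _ f) (sum-cong-≗ λ i → *-distribˡ-sum (f i) f)

0≤i*i : ∀ i → 0ℤ ≤ i * i
0≤i*i (+ n)    = subst (0ℤ ≤_) (ℤₚ.pos-* n n) (+≤+ ℕ.z≤n)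
0≤i*i -[1+ n ] = +≤+ ℕ.z≤n

-- Iverson brackets, for counting with integer sums.

⟦_⟧ : Dec P → ℤ
⟦ P? ⟧ = if does P? then 1ℤ else 0ℤ

⟦⟧-yes : (P? : Dec P) → P → ⟦ P? ⟧ ≡ 1ℤ
⟦⟧-yes (yes _) _ = refl
⟦⟧-yes (no ¬p) p = contradiction p ¬p

⟦⟧-no : (P? : Dec P) → ¬ P → ⟦ P? ⟧ ≡ 0ℤ
⟦⟧-no (yes p) ¬p = contradiction p ¬p
⟦⟧-no (no _)  _  = refl

0≤⟦⟧ : (P? : Dec P) → 0ℤ ≤ ⟦ P? ⟧
0≤⟦⟧ (yes _) = +≤+ ℕ.z≤n
0≤⟦⟧ (no _)  = ≤-refl

⟦⟧≤1 : (P? : Dec P) → ⟦ P? ⟧ ≤ 1ℤ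
⟦⟧≤1 (yes _) = ≤-refl
⟦⟧≤1 (no _)  = +≤+ ℕ.z≤n

⟦⟧-idem : (P? : Dec P) → ⟦ P? ⟧ * ⟦ P? ⟧ ≡ ⟦ P? ⟧
⟦⟧-idem (yes _) = refl
⟦⟧-idem (no _)  = refl

⟦⟧-mono : (P? : Dec P) (Q? : Dec Q) → (P → Q) → ⟦ P? ⟧ ≤ ⟦ Q? ⟧
⟦⟧-mono (yes p) Q? f = ≤-reflexive (sym (⟦⟧-yes Q? (f p)))
⟦⟧-mono (no _)  Q? _ = 0≤⟦⟧ Q?

⟦⟧-⊎ : (P? : Dec P) (Q? : Dec Q) (R? : Dec R) → (P → Q ⊎ R) → ⟦ P? ⟧ ≤ ⟦ Q? ⟧ + ⟦ R? ⟧
⟦⟧-⊎ (no _)  Q? R? f = ℤₚ.+-mono-≤ (0≤⟦⟧ Q?) (0≤⟦⟧ R?)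
⟦⟧-⊎ (yes p) Q? R? f with f p
... | inj₁ q = ℤₚ.+-mono-≤ (≤-reflexive (sym (⟦⟧-yes Q? q))) (0≤⟦⟧ R?)
... | inj₂ r = ℤₚ.+-mono-≤ (0≤⟦⟧ Q?) (≤-reflexive (sym (⟦⟧-yes R? r)))

⟦⟧*⟦⟧≤ : (P? : Dec P) (Q? : Dec Q) → ⟦ P? ⟧ * ⟦ Q? ⟧ ≤ ⟦ P? ⟧
⟦⟧*⟦⟧≤ (yes _) Q? = subst (_≤ 1ℤ) (sym (ℤₚ.*-identityˡ ⟦ Q? ⟧)) (⟦⟧≤1 Q?)
⟦⟧*⟦⟧≤ (no _)  Q? = ≤-refl

⟦⟧*⟦⟧≡0 : (P? : Dec P) (Q? : Dec Q) → (P → ¬ Q) → ⟦ P? ⟧ * ⟦ Q? ⟧ ≡ 0ℤ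
⟦⟧*⟦⟧≡0 (yes p) Q? ¬q = trans (ℤₚ.*-identityˡ ⟦ Q? ⟧) (⟦⟧-no Q? (¬q p))
⟦⟧*⟦⟧≡0 (no _)  Q? _  = refl

⟦⟧-split : (P? : Dec P) (Q? : Dec Q) (R? : Dec R) →
  (P → Q ⊎ R) → (Q → P) → (R → P) → (Q → ¬ R) → ⟦ P? ⟧ ≡ ⟦ Q? ⟧ + ⟦ R? ⟧
⟦⟧-split P?      (yes q) R? _ q⇒p _ q⇒¬r = trans (⟦⟧-yes P? (q⇒p q)) (cong ℤ.suc (sym (⟦⟧-no R? (q⇒¬r q))))
⟦⟧-split (no ¬p) (no ¬q) R? _ _ r⇒p _ = cong (λ s → 0ℤ + s) (sym (⟦⟧-no R? (¬p ∘ r⇒p)))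
⟦⟧-split (yes p) (no ¬q) R? p⇒q⊎r _ _ _ with p⇒q⊎r p
... | inj₁ q = contradiction q ¬q
... | inj₂ r = cong (λ s → 0ℤ + s) (sym (⟦⟧-yes R? r))

-- The bracket is a Kronecker delta. Read from right to left, this introduces a new summation
-- variable tied to `i`, which is how sums are later regrouped by fibres.
∑-select : ∀ {n} (i : Fin n) (f : Fin n → ℤ) → ∑[ j < n ] (⟦ i ≟ j ⟧ * f j) ≡ f i
∑-select {ℕ.suc n} zero f = begin
  1ℤ * f zero + ∑[ j < n ] (0ℤ * f (suc j)) ≡⟨ cong₂ _+_ (ℤₚ.*-identityˡ (f zero)) (∑-zero {n} λ _ → refl) ⟩
  f zero + 0ℤ                               ≡⟨ ℤₚ.+-identityʳ (f zero) ⟩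
  f zero                                    ∎
  where open ≡-Reasoning
∑-select {ℕ.suc n} (suc i) f = begin
  0ℤ * f zero + ∑[ j < n ] (⟦ i ≟ j ⟧ * f (suc j)) ≡⟨ cong (λ s → 0ℤ + s) (∑-select i (f ∘ suc)) ⟩
  0ℤ + f (suc i)                                   ≡⟨ ℤₚ.+-identityˡ (f (suc i)) ⟩
  f (suc i)                                        ∎
  where open ≡-Reasoning

∑-δ : ∀ {n} (i : Fin n) → ∑[ j < n ] ⟦ i ≟ j ⟧ ≡ 1ℤ
∑-δ i = trans (sum-cong-≗ λ j → sym (ℤₚ.*-identityʳ ⟦ i ≟ j ⟧)) (∑-select i λ _ → 1ℤ)

-- The concluding arithmetic.

-- Here `n` stands for the number of powers, `m` for the number of nonzero ones and `r` for the
-- number of non-powers. With `r ≤ m k`, both sides of the last hypothesis share the factor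
-- `w = m² (q n)²`; cancelling it leaves `n² ≤ q k²`. Together with `q ≤ n k` this gives
-- `q² ≤ n² k² ≤ q k⁴`.
q≤k⁴ : ∀ k q m r .{{_ : NonZero k}} → let n = ℕ.suc m in
  q ≡ n ℕ.+ r → q ℕ.≤ ℕ.suc (m ℕ.* k) →
  m ℕ.* m ℕ.* ((q ℕ.* (n ℕ.* n)) ℕ.* (q ℕ.* (n ℕ.* n))) ℕ.≤ q ℕ.* (q ℕ.* n ℕ.* r) ℕ.* (q ℕ.* n ℕ.* r) →
  q ℕ.≤ k ^ 4
-- For `m = 0` the common factor is zero and cannot be cancelled, but then `q ≤ 1 ≤ k⁴`.
q≤k⁴ k q ℕ.zero r _ q≤1 _ = ℕₚ.≤-trans q≤1 (ℕₚ.m^n>0 k 4)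
q≤k⁴ k q@(ℕ.suc _) m@(ℕ.suc _) r q≡n+r q≤1+mk moment = ℕₚ.*-cancelˡ-≤ q (begin
  q ℕ.* q                         ≤⟨ ℕₚ.*-mono-≤ q≤nk q≤nk ⟩
  (n ℕ.* k) ℕ.* (n ℕ.* k)         ≡⟨ expand n k ⟩
  (n ℕ.* n) ℕ.* (k ℕ.* k)         ≤⟨ ℕₚ.*-monoˡ-≤ (k ℕ.* k) n²≤qk² ⟩
  q ℕ.* (k ℕ.* k) ℕ.* (k ℕ.* k)   ≡⟨ collect q k ⟩
  q ℕ.* k ^ 4                     ∎)
  where
  open ℕₚ.≤-Reasoning
  n = ℕ.suc m
  w = m ℕ.* m ℕ.* (q ℕ.* n ℕ.* (q ℕ.* n))

  expand : ∀ n k → (n ℕ.* k) ℕ.* (n ℕ.* k) ≡ (n ℕ.* n) ℕ.* (k ℕ.* k)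
  expand = ℕ-Solver.solve-∀
  collect : ∀ q k → q ℕ.* (k ℕ.* k) ℕ.* (k ℕ.* k) ≡ q ℕ.* (k ℕ.* (k ℕ.* (k ℕ.* (k ℕ.* 1))))
  collect = ℕ-Solver.solve-∀
  left : ∀ m n q → n ℕ.* n ℕ.* (m ℕ.* m ℕ.* (q ℕ.* n ℕ.* (q ℕ.* n)))
                 ≡ m ℕ.* m ℕ.* ((q ℕ.* (n ℕ.* n)) ℕ.* (q ℕ.* (n ℕ.* n)))
  left = ℕ-Solver.solve-∀
  right : ∀ m n q k → q ℕ.* (q ℕ.* n ℕ.* (m ℕ.* k)) ℕ.* (q ℕ.* n ℕ.* (m ℕ.* k))
                    ≡ q ℕ.* (k ℕ.* k) ℕ.* (m ℕ.* m ℕ.* (q ℕ.* n ℕ.* (q ℕ.* n)))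
  right = ℕ-Solver.solve-∀

  q≤nk : q ℕ.≤ n ℕ.* k
  -- The summand 1 is bounded by `k`, so that `1 + m k ≤ k + m k = n k`.
  q≤nk = ℕₚ.≤-trans q≤1+mk (ℕₚ.+-monoˡ-≤ (m ℕ.* k) (ℕ.>-nonZero⁻¹ k))

  r≤mk : r ℕ.≤ m ℕ.* k
  -- Removing 1 from both sides of `1 + m + r ≤ 1 + m k` gives `r ≤ m + r ≤ m k`.
  r≤mk = ℕₚ.≤-trans (ℕₚ.m≤n+m r m) (ℕ.s≤s⁻¹ (subst (ℕ._≤ ℕ.suc (m ℕ.* k)) q≡n+r q≤1+mk))

  n²≤qk² : n ℕ.* n ℕ.≤ q ℕ.* (k ℕ.* k)
  n²≤qk² = ℕₚ.*-cancelʳ-≤ (n ℕ.* n) (q ℕ.* (k ℕ.* k)) w (begin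
    n ℕ.* n ℕ.* w                                                    ≡⟨ left m n q ⟩
    m ℕ.* m ℕ.* ((q ℕ.* (n ℕ.* n)) ℕ.* (q ℕ.* (n ℕ.* n)))            ≤⟨ moment ⟩
    q ℕ.* (q ℕ.* n ℕ.* r) ℕ.* (q ℕ.* n ℕ.* r)
      ≤⟨ ℕₚ.*-mono-≤ (ℕₚ.*-monoʳ-≤ q (ℕₚ.*-monoʳ-≤ (q ℕ.* n) r≤mk)) (ℕₚ.*-monoʳ-≤ (q ℕ.* n) r≤mk) ⟩
    q ℕ.* (q ℕ.* n ℕ.* (m ℕ.* k)) ℕ.* (q ℕ.* n ℕ.* (m ℕ.* k))        ≡⟨ right m n q k ⟩
    q ℕ.* (k ℕ.* k) ℕ.* w                                            ∎)

-- The moments are computed in `ℤ` because the summands can be negative, while the cancellations are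
-- done in `ℕ`. The sign hypotheses on `M` and `R` allow the passage.
q≤k⁴-ℤ : ∀ k q M R .{{_ : NonZero k}} → let N = 1ℤ + M in
  0ℤ ≤ M → 0ℤ ≤ R → + q ≡ N + R → + q ≤ 1ℤ + M * + k →
  M * M * ((+ q * (N * N)) * (+ q * (N * N))) ≤ + q * (+ q * N * R) * (+ q * N * R) →
  q ℕ.≤ k ^ 4
q≤k⁴-ℤ k q (+ m) (+ r) _ _ q≡n+r q≤1+mk moment = q≤k⁴ k q m r
  (ℤₚ.+-injective q≡n+r)
  (ℤₚ.drop‿+≤+ (subst (λ z → + q ≤ 1ℤ + z) (sym (ℤₚ.pos-* m k)) q≤1+mk))
  (ℤₚ.drop‿+≤+ (subst₂ _≤_ (sym lhs) (sym rhs) moment))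
  where
  n = ℕ.suc m

  pos-** : ∀ {a b x y} → + a ≡ x → + b ≡ y → + (a ℕ.* b) ≡ x * y
  pos-** {a} {b} p r = trans (ℤₚ.pos-* a b) (cong₂ _*_ p r)

  c : + (q ℕ.* (n ℕ.* n)) ≡ + q * (+ n * + n)
  c = pos-** {q} refl (ℤₚ.pos-* n n)
  d : + (q ℕ.* n ℕ.* r) ≡ + q * + n * + r
  d = pos-** {b = r} (ℤₚ.pos-* q n) refl
  lhs : + (m ℕ.* m ℕ.* ((q ℕ.* (n ℕ.* n)) ℕ.* (q ℕ.* (n ℕ.* n))))
      ≡ + m * + m * ((+ q * (+ n * + n)) * (+ q * (+ n * + n)))
  lhs = pos-** (ℤₚ.pos-* m m) (pos-** c c)
  rhs : + (q ℕ.* (q ℕ.* n ℕ.* r) ℕ.* (q ℕ.* n ℕ.* r)) ≡ + q * (+ q * + n * + r) * (+ q * + n * + r)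
  rhs = pos-** (pos-** {q} refl d) d

-- Fields carried by `Fin q`.

-- With `Fin q` as carrier and propositional equality, a sum over the field is a sum over `Fin q`,
-- and existence statements over the field are decided by search.
record FiniteField (q : ℕ) : Set where
  infixl 7 _⊗_
  infixl 6 _⊕_
  infix  8 ⊝_
  field
    _⊕_ _⊗_           : Op₂ (Fin q)
    ⊝_                : Op₁ (Fin q)
    0ᶠ 1ᶠ             : Fin q
    isCommutativeRing : IsCommutativeRing _≡_ _⊕_ _⊗_ ⊝_ 0ᶠ 1ᶠ
    1≢0               : 1ᶠ ≢ 0ᶠ
    invert            : ∀ x → x ≢ 0ᶠ → ∃[ y ] x ⊗ y ≡ 1ᶠ

  commutativeRing : CommutativeRing 0ℓ 0ℓ
  commutativeRing = record { isCommutativeRing = isCommutativeRing }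

  open Exp (CommutativeRing.semiring commutativeRing) public using () renaming (_^_ to _^ᶠ_)

module _ {q : ℕ} (F : FiniteField q) where

  open FiniteField F

  open CommutativeRing commutativeRing
    using (+-comm; +-identityˡ; -‿inverseˡ; *-comm; *-assoc; *-identityˡ; *-identityʳ;
           zeroˡ; zeroʳ; distribˡ; ring; +-group; commutativeSemiring)
  open GroupProperties +-group
    using (//-rightDividesˡ; //-rightDividesʳ; x∙y⁻¹≈ε⇒x≈y; ⁻¹-involutive)
  open RingProperties ring using (-‿distribʳ-*)
  open CommutativeExp commutativeSemiring using (^-distrib-*)
  open NaturalSolver commutativeSemiring using (solve; _:+_; _:*_; _:=_)

  noZeroDivisors : ∀ x y → x ⊗ y ≡ 0ᶠ → x ≡ 0ᶠ ⊎ y ≡ 0ᶠ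
  noZeroDivisors x y xy≡0 with x ≟ 0ᶠ
  ... | yes x≡0 = inj₁ x≡0
  ... | no x≢0 with z , xz≡1 ← invert x x≢0 = inj₂ (begin
    y             ≡⟨ *-identityˡ y ⟨
    1ᶠ ⊗ y        ≡⟨ cong (_⊗ y) xz≡1 ⟨
    x ⊗ z ⊗ y     ≡⟨ solve 3 (λ x y z → x :* z :* y := z :* (x :* y)) refl x y z ⟩
    z ⊗ (x ⊗ y)   ≡⟨ cong (z ⊗_) xy≡0 ⟩
    z ⊗ 0ᶠ        ≡⟨ zeroʳ z ⟩
    0ᶠ            ∎)
    where open ≡-Reasoning

  ^-nonZero : ∀ x k → x ≢ 0ᶠ → x ^ᶠ k ≢ 0ᶠ
  ^-nonZero x ℕ.zero    x≢0 = 1≢0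
  ^-nonZero x (ℕ.suc k) x≢0 eq with noZeroDivisors x (x ^ᶠ k) eq
  ... | inj₁ x≡0 = x≢0 x≡0
  ... | inj₂ p   = ^-nonZero x k x≢0 p

  0^k≡0 : ∀ k .{{_ : NonZero k}} → 0ᶠ ^ᶠ k ≡ 0ᶠ
  0^k≡0 (ℕ.suc k) = zeroˡ _

  -- Roots of polynomials and fibres of the power map.

  -- Coefficients, constant term first, of a monic polynomial of degree n.
  Monic : ℕ → Set
  Monic = Vec (Fin q)

  -- Horner's scheme. The leading coefficient 1 is not stored, so the empty vector is the constant
  -- polynomial 1.
  eval : ∀ {n} → Monic n → Fin q → Fin q
  eval []      x = 1ᶠ
  eval (a ∷ p) x = a ⊕ x ⊗ eval p x

  -- Synthetic division by `X - r`: the values at `r` of the successive tails are the coefficients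
  -- of the quotient.
  quotient : ∀ {n} → Monic (ℕ.suc n) → Fin q → Monic n
  quotient (a ∷ [])    r = []
  quotient (a ∷ b ∷ p) r = eval (b ∷ p) r ∷ quotient (b ∷ p) r

  -- This is `p(x) = p(r) + (x - r) Q(x)` with `x` written as `d ⊕ r`; without subtraction the
  -- identity is within reach of the semiring solver.
  eval-quotient : ∀ {n} (p : Monic (ℕ.suc n)) r d →
    eval p (d ⊕ r) ≡ eval p r ⊕ d ⊗ eval (quotient p r) (d ⊕ r)
  eval-quotient (a ∷ []) r d =
    solve 4 (λ a r d o → a :+ (d :+ r) :* o := a :+ r :* o :+ d :* o) refl a r d 1ᶠ
  eval-quotient (a ∷ p@(_ ∷ _)) r d = begin
    a ⊕ (d ⊕ r) ⊗ eval p (d ⊕ r)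
      ≡⟨ cong (λ e → a ⊕ (d ⊕ r) ⊗ e) (eval-quotient p r d) ⟩
    a ⊕ (d ⊕ r) ⊗ (pr ⊕ d ⊗ q′)
      ≡⟨ solve 5 (λ a r d pr q′ → a :+ (d :+ r) :* (pr :+ d :* q′)
                    := a :+ r :* pr :+ d :* (pr :+ (d :+ r) :* q′)) refl a r d pr q′ ⟩
    a ⊕ r ⊗ pr ⊕ d ⊗ (pr ⊕ (d ⊕ r) ⊗ q′) ∎
    where
    open ≡-Reasoning
    pr = eval p r
    q′ = eval (quotient p r) (d ⊕ r)

  root-of-quotient : ∀ {n} (p : Monic (ℕ.suc n)) r x → eval p r ≡ 0ᶠ → eval p x ≡ 0ᶠ →
    r ≡ x ⊎ eval (quotient p r) x ≡ 0ᶠ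
  root-of-quotient p r x pr≡0 px≡0 with noZeroDivisors d (eval (quotient p r) x) dQ≡0
    where
    open ≡-Reasoning
    d = x ⊕ ⊝ r
    d⊕r≡x : d ⊕ r ≡ x
    d⊕r≡x = //-rightDividesˡ r x
    dQ≡0 : d ⊗ eval (quotient p r) x ≡ 0ᶠ
    dQ≡0 = begin
      d ⊗ eval (quotient p r) x                  ≡⟨ +-identityˡ _ ⟨
      0ᶠ ⊕ d ⊗ eval (quotient p r) x             ≡⟨ cong₂ (λ e y → e ⊕ d ⊗ eval (quotient p r) y) pr≡0 d⊕r≡x ⟨
      eval p r ⊕ d ⊗ eval (quotient p r) (d ⊕ r) ≡⟨ eval-quotient p r d ⟨
      eval p (d ⊕ r)                             ≡⟨ cong (eval p) d⊕r≡x ⟩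
      eval p x                                   ≡⟨ px≡0 ⟩
      0ᶠ                                         ∎
  ... | inj₁ d≡0 = inj₁ (sym (x∙y⁻¹≈ε⇒x≈y x r d≡0))
  ... | inj₂ eq  = inj₂ eq

  -- Induction on the degree: once a root `r` is found, every root is `r` itself or a root of the
  -- quotient.
  root-count : ∀ {n} (p : Monic n) → ∑[ x < q ] ⟦ eval p x ≟ 0ᶠ ⟧ ≤ + n
  root-count [] = ≤-reflexive (∑-zero {q} λ _ → ⟦⟧-no (1ᶠ ≟ 0ᶠ) 1≢0)
  root-count {ℕ.suc n} p@(_ ∷ _) with any? (λ r → eval p r ≟ 0ᶠ)
  ... | no ¬root = ≤-trans
    (≤-reflexive (∑-zero {q} λ x → ⟦⟧-no (eval p x ≟ 0ᶠ) λ px≡0 → ¬root (x , px≡0)))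
    (+≤+ ℕ.z≤n)
  ... | yes (r , pr≡0) = begin
    ∑[ x < q ] ⟦ eval p x ≟ 0ᶠ ⟧
      ≤⟨ ∑-mono {q} (λ x → ⟦⟧-⊎ (eval p x ≟ 0ᶠ) (r ≟ x) (eval p′ x ≟ 0ᶠ) (root-of-quotient p r x pr≡0)) ⟩
    ∑[ x < q ] (⟦ r ≟ x ⟧ + ⟦ eval p′ x ≟ 0ᶠ ⟧)
      ≡⟨ ∑-distrib-+ {q} _ _ ⟩
    ∑[ x < q ] ⟦ r ≟ x ⟧ + ∑[ x < q ] ⟦ eval p′ x ≟ 0ᶠ ⟧
      ≤⟨ ℤₚ.+-mono-≤ (≤-reflexive (∑-δ r)) (root-count p′) ⟩
    + ℕ.suc n ∎
    where
    open ℤₚ.≤-Reasoning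
    p′ = quotient p r

  eval-replicate : ∀ n x → eval (replicate n 0ᶠ) x ≡ x ^ᶠ n
  eval-replicate ℕ.zero    x = refl
  eval-replicate (ℕ.suc n) x = trans (+-identityˡ _) (cong (x ⊗_) (eval-replicate n x))

  power-roots : ∀ k .{{_ : NonZero k}} c → ∑[ x < q ] ⟦ x ^ᶠ k ≟ c ⟧ ≤ + k
  power-roots (ℕ.suc k) c = ≤-trans
    (∑-mono {q} λ x → ⟦⟧-mono (x ^ᶠ ℕ.suc k ≟ c) (eval p x ≟ 0ᶠ) (root x)) (root-count p)
    where
    open ≡-Reasoning
    -- The polynomial `X^(k+1) - c`: constant term, then `k` zero coefficients, then the implicit
    -- leading 1.
    p = ⊝ c ∷ replicate k 0ᶠ
    root : ∀ x → x ^ᶠ ℕ.suc k ≡ c → eval p x ≡ 0ᶠ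
    root x x^k≡c = begin
      ⊝ c ⊕ x ⊗ eval (replicate k 0ᶠ) x ≡⟨ cong (λ e → ⊝ c ⊕ x ⊗ e) (eval-replicate k x) ⟩
      ⊝ c ⊕ x ^ᶠ ℕ.suc k                ≡⟨ cong (⊝ c ⊕_) x^k≡c ⟩
      ⊝ c ⊕ c                           ≡⟨ -‿inverseˡ c ⟩
      0ᶠ                                ∎

  -- Substitutions in sums over the field.

  -- Multiplication by the inverse `d` of `c` makes the affine map a permutation of the field.
  ∑-affine : ∀ (f : Fin q → ℤ) b c → c ≢ 0ᶠ → ∑[ t < q ] f (b ⊕ t ⊗ c) ≡ ∑[ x < q ] f x
  ∑-affine f b c c≢0 with d , cd≡1 ← invert c c≢0 = sym (∑-permute f (permutation to from to-from from-to))
    where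
    open ≡-Reasoning
    to from : Fin q → Fin q
    to t   = b ⊕ t ⊗ c
    from x = (x ⊕ ⊝ b) ⊗ d

    cancel : ∀ x → x ⊗ (c ⊗ d) ≡ x
    cancel x = trans (cong (x ⊗_) cd≡1) (*-identityʳ x)

    to-from : ∀ x → to (from x) ≡ x
    to-from x = begin
      b ⊕ (x ⊕ ⊝ b) ⊗ d ⊗ c   ≡⟨ solve 4 (λ b y c d → b :+ y :* d :* c := y :* (c :* d) :+ b) refl b (x ⊕ ⊝ b) c d ⟩
      (x ⊕ ⊝ b) ⊗ (c ⊗ d) ⊕ b ≡⟨ cong (_⊕ b) (cancel (x ⊕ ⊝ b)) ⟩
      (x ⊕ ⊝ b) ⊕ b           ≡⟨ //-rightDividesˡ b x ⟩
      x                       ∎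

    from-to : ∀ t → from (to t) ≡ t
    from-to t = begin
      (b ⊕ t ⊗ c ⊕ ⊝ b) ⊗ d   ≡⟨ cong (λ y → (y ⊕ ⊝ b) ⊗ d) (+-comm b (t ⊗ c)) ⟩
      (t ⊗ c ⊕ b ⊕ ⊝ b) ⊗ d   ≡⟨ cong (_⊗ d) (//-rightDividesʳ b (t ⊗ c)) ⟩
      t ⊗ c ⊗ d               ≡⟨ *-assoc t c d ⟩
      t ⊗ (c ⊗ d)             ≡⟨ cancel t ⟩
      t                       ∎

  ∑-shift : ∀ (f : Fin q → ℤ) b → ∑[ x < q ] f (x ⊕ b) ≡ ∑[ x < q ] f x
  ∑-shift f b = trans
    (sum-cong-≗ λ x → cong f (trans (+-comm x b) (cong (b ⊕_) (sym (*-identityʳ x)))))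
    (∑-affine f b 1ᶠ 1≢0)

  ∑-negate : ∀ (f : Fin q → ℤ) → ∑[ x < q ] f (⊝ x) ≡ ∑[ x < q ] f x
  ∑-negate f = sym (∑-permute f (permutation ⊝_ ⊝_ ⁻¹-involutive ⁻¹-involutive))

  -- The second moment of a function with sum zero.

  module _ (g : Fin q → ℤ) (∑g≡0 : ∑[ x < q ] g x ≡ 0ℤ) where

    private
      ‖g‖² = ∑[ x < q ] (g x * g x)

    -- For `y = z` each inner sum is a translate of the sum of squares. For `y ≢ z`, put
    -- `w = x ⊕ t ⊗ y` and `d = z ⊕ ⊝ y`; the second argument becomes `w ⊕ t ⊗ d`, which for fixed
    -- `w` runs over the whole field with `t`, and `g` sums to zero.
    correlation : ∀ y z →
      ∑[ t < q ] ∑[ x < q ] (g (x ⊕ t ⊗ y) * g (x ⊕ t ⊗ z)) ≡ ⟦ y ≟ z ⟧ * (+ q * ‖g‖²)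
    correlation y z with y ≟ z
    ... | yes refl = begin
      ∑[ t < q ] ∑[ x < q ] (g (x ⊕ t ⊗ y) * g (x ⊕ t ⊗ y))
        ≡⟨ sum-cong-≗ {q} (λ t → ∑-shift (λ w → g w * g w) (t ⊗ y)) ⟩
      ∑[ t < q ] ‖g‖²   ≡⟨ ∑-const q ‖g‖² ⟩
      + q * ‖g‖²        ≡⟨ ℤₚ.*-identityˡ _ ⟨
      1ℤ * (+ q * ‖g‖²) ∎
      where open ≡-Reasoning
    ... | no y≢z = begin
      ∑[ t < q ] ∑[ x < q ] (g (x ⊕ t ⊗ y) * g (x ⊕ t ⊗ z))
        ≡⟨ sum-cong-≗ {q} (λ t → sum-cong-≗ {q} λ x → cong (λ w → g (x ⊕ t ⊗ y) * g w) (split t x)) ⟩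
      ∑[ t < q ] ∑[ x < q ] (g (x ⊕ t ⊗ y) * g (x ⊕ t ⊗ y ⊕ t ⊗ d))
        ≡⟨ sum-cong-≗ {q} (λ t → ∑-shift (λ w → g w * g (w ⊕ t ⊗ d)) (t ⊗ y)) ⟩
      ∑[ t < q ] ∑[ w < q ] (g w * g (w ⊕ t ⊗ d))
        ≡⟨ ∑-comm {q} {q} (λ t w → g w * g (w ⊕ t ⊗ d)) ⟩
      ∑[ w < q ] ∑[ t < q ] (g w * g (w ⊕ t ⊗ d))
        ≡⟨ ∑-zero {q} vanish ⟩
      0ℤ ≡⟨ ℤₚ.*-zeroˡ (+ q * ‖g‖²) ⟨
      0ℤ * (+ q * ‖g‖²) ∎
      where
      open ≡-Reasoning
      d = z ⊕ ⊝ y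
      d≢0 : d ≢ 0ᶠ
      d≢0 d≡0 = y≢z (sym (x∙y⁻¹≈ε⇒x≈y z y d≡0))
      split : ∀ t x → x ⊕ t ⊗ z ≡ x ⊕ t ⊗ y ⊕ t ⊗ d
      split t x = trans (cong (λ z → x ⊕ t ⊗ z) (sym (//-rightDividesˡ y z)))
        (solve 4 (λ x t d y → x :+ t :* (d :+ y) := x :+ t :* y :+ t :* d) refl x t d y)
      vanish : ∀ w → ∑[ t < q ] (g w * g (w ⊕ t ⊗ d)) ≡ 0ℤ
      vanish w = begin
        ∑[ t < q ] (g w * g (w ⊕ t ⊗ d)) ≡⟨ *-distribˡ-sum {q} (g w) (λ t → g (w ⊕ t ⊗ d)) ⟨
        g w * ∑[ t < q ] g (w ⊕ t ⊗ d) ≡⟨ cong (g w *_) (∑-affine g w d d≢0) ⟩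
        g w * ∑[ t < q ] g t           ≡⟨ cong (g w *_) ∑g≡0 ⟩
        g w * 0ℤ                       ≡⟨ ℤₚ.*-zeroʳ (g w) ⟩
        0ℤ                             ∎

    -- The square expands into a double sum over `y` and `z`, of which `correlation` leaves only the
    -- diagonal.
    second-moment : ∀ (h : Fin q → ℤ) →
      let T = λ t x → ∑[ y < q ] (g (x ⊕ t ⊗ y) * h y) in
      ∑[ t < q ] ∑[ x < q ] (T t x * T t x) ≡ + q * ‖g‖² * ∑[ y < q ] (h y * h y)
    second-moment h = begin
      ∑[ t < q ] ∑[ x < q ] (T t x * T t x)
        ≡⟨ sum-cong-≗ {q} (λ t → sum-cong-≗ {q} λ x → sum-squared {q} (λ y → G t x y * h y)) ⟩
      ∑[ t < q ] ∑[ x < q ] ∑[ y < q ] ∑[ z < q ] ((G t x y * h y) * (G t x z * h z))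
        -- The four interchanges move the sums over `t` and `x` inside those over `y` and `z`, where
        -- `correlation` applies.
        ≡⟨ sum-cong-≗ {q} (λ t → ∑-comm {q} {q} _) ⟩
      ∑[ t < q ] ∑[ y < q ] ∑[ x < q ] ∑[ z < q ] ((G t x y * h y) * (G t x z * h z))
        ≡⟨ ∑-comm {q} {q} _ ⟩
      ∑[ y < q ] ∑[ t < q ] ∑[ x < q ] ∑[ z < q ] ((G t x y * h y) * (G t x z * h z))
        ≡⟨ sum-cong-≗ {q} (λ y → sum-cong-≗ {q} λ t → ∑-comm {q} {q} _) ⟩
      ∑[ y < q ] ∑[ t < q ] ∑[ z < q ] ∑[ x < q ] ((G t x y * h y) * (G t x z * h z))
        ≡⟨ sum-cong-≗ {q} (λ y → ∑-comm {q} {q} _) ⟩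
      ∑[ y < q ] ∑[ z < q ] ∑[ t < q ] ∑[ x < q ] ((G t x y * h y) * (G t x z * h z))
        ≡⟨ sum-cong-≗ {q} (λ y → sum-cong-≗ {q} λ z → factor y z) ⟩
      ∑[ y < q ] ∑[ z < q ] (⟦ y ≟ z ⟧ * (+ q * ‖g‖² * (h y * h z)))
        ≡⟨ sum-cong-≗ {q} (λ y → ∑-select y (λ z → + q * ‖g‖² * (h y * h z))) ⟩
      ∑[ y < q ] (+ q * ‖g‖² * (h y * h y))
        ≡⟨ *-distribˡ-sum {q} (+ q * ‖g‖²) (λ y → h y * h y) ⟨
      + q * ‖g‖² * ∑[ y < q ] (h y * h y) ∎
      where
      open ≡-Reasoning
      G : Fin q → Fin q → Fin q → ℤ
      G t x y = g (x ⊕ t ⊗ y)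
      T : Fin q → Fin q → ℤ
      T t x = ∑[ y < q ] (G t x y * h y)
      rearrange : ∀ a b c d → (a * b) * (c * d) ≡ (b * d) * (a * c)
      rearrange = solve-∀
      regroup : ∀ a b c d → a * b * (c * d) ≡ c * (d * (a * b))
      regroup = solve-∀
      factor : ∀ y z → ∑[ t < q ] ∑[ x < q ] ((G t x y * h y) * (G t x z * h z))
                     ≡ ⟦ y ≟ z ⟧ * (+ q * ‖g‖² * (h y * h z))
      factor y z = begin
        ∑[ t < q ] ∑[ x < q ] ((G t x y * h y) * (G t x z * h z))
          ≡⟨ sum-cong-≗ {q} (λ t → sum-cong-≗ {q} λ x → rearrange (G t x y) (h y) (G t x z) (h z)) ⟩
        ∑[ t < q ] ∑[ x < q ] (h y * h z * (G t x y * G t x z))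
          ≡⟨ sum-cong-≗ {q} (λ t → *-distribˡ-sum {q} (h y * h z) (λ x → G t x y * G t x z)) ⟨
        ∑[ t < q ] (h y * h z * ∑[ x < q ] (G t x y * G t x z))
          ≡⟨ *-distribˡ-sum {q} (h y * h z) (λ t → ∑[ x < q ] (G t x y * G t x z)) ⟨
        h y * h z * ∑[ t < q ] ∑[ x < q ] (G t x y * G t x z)
          ≡⟨ cong (h y * h z *_) (correlation y z) ⟩
        h y * h z * (⟦ y ≟ z ⟧ * (+ q * ‖g‖²))
          ≡⟨ regroup (h y) (h z) ⟦ y ≟ z ⟧ (+ q * ‖g‖²) ⟩
        ⟦ y ≟ z ⟧ * (+ q * ‖g‖² * (h y * h z)) ∎

  -- Counting the powers.

  module _ (k : ℕ) .{{_ : NonZero k}} where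

    IsPower : Fin q → Set
    IsPower x = ∃[ u ] u ^ᶠ k ≡ x

    power? : ∀ x → Dec (IsPower x)
    power? x = any? λ u → u ^ᶠ k ≟ x

    nonZeroPower? : ∀ x → Dec (x ≢ 0ᶠ × IsPower x)
    nonZeroPower? x = ¬? (x ≟ 0ᶠ) ×-dec power? x

    -- `χ` has mean `N / q`, and `g` is its deviation from that mean, multiplied by `q` to remain
    -- integral.
    χ η g : Fin q → ℤ
    N M : ℤ
    χ x = ⟦ power? x ⟧
    η x = ⟦ nonZeroPower? x ⟧
    N   = ∑[ x < q ] χ x
    M   = ∑[ x < q ] η x
    g x = + q * χ x + - N

    0≤M : 0ℤ ≤ M
    0≤M = subst (_≤ M) (∑-zero {q} λ _ → refl) (∑-mono {q} λ x → 0≤⟦⟧ (nonZeroPower? x))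

    -- The extra power is `0ᶠ`, which is its own `k`-th power because `k` is positive.
    N≡1+M : N ≡ 1ℤ + M
    N≡1+M = begin
      ∑[ x < q ] χ x                              ≡⟨ sum-cong-≗ {q} split ⟩
      ∑[ x < q ] (⟦ 0ᶠ ≟ x ⟧ + η x)               ≡⟨ ∑-distrib-+ {q} _ _ ⟩
      ∑[ x < q ] ⟦ 0ᶠ ≟ x ⟧ + ∑[ x < q ] η x      ≡⟨ cong (_+ M) (∑-δ 0ᶠ) ⟩
      1ℤ + M                                      ∎
      where
      open ≡-Reasoning
      cover : ∀ x → IsPower x → 0ᶠ ≡ x ⊎ (x ≢ 0ᶠ × IsPower x)
      cover x p with 0ᶠ ≟ x
      ... | yes 0≡x = inj₁ 0≡x
      ... | no 0≢x  = inj₂ (0≢x ∘ sym , p)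
      split : ∀ x → χ x ≡ ⟦ 0ᶠ ≟ x ⟧ + η x
      split x = ⟦⟧-split (power? x) (0ᶠ ≟ x) (nonZeroPower? x)
        (cover x) (λ { refl → 0ᶠ , 0^k≡0 k }) proj₂ (λ { refl (0≢0 , _) → 0≢0 refl })

    N≤q : N ≤ + q
    N≤q = ≤-trans (∑-mono {q} λ x → ⟦⟧≤1 (power? x))
      (≤-reflexive (trans (∑-const q 1ℤ) (ℤₚ.*-identityʳ (+ q))))

    -- Set `0ᶠ` aside and sort the remaining `u` by the value of `u ^ᶠ k`. Only the `M` nonzero
    -- powers occur as values, each at most `k` times by `power-roots`.
    q≤1+Mk : + q ≤ 1ℤ + M * + k
    q≤1+Mk = begin
      + q                                         ≡⟨ trans (∑-const q 1ℤ) (ℤₚ.*-identityʳ (+ q)) ⟨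
      ∑[ u < q ] 1ℤ                               ≡⟨ sum-cong-≗ {q} split ⟩
      ∑[ u < q ] (⟦ 0ᶠ ≟ u ⟧ + ν u)               ≡⟨ ∑-distrib-+ {q} _ _ ⟩
      ∑[ u < q ] ⟦ 0ᶠ ≟ u ⟧ + ∑[ u < q ] ν u      ≡⟨ cong (_+ ∑[ u < q ] ν u) (∑-δ 0ᶠ) ⟩
      -- The value `x` of `u ^ᶠ k` enters as a second summation variable.
      1ℤ + ∑[ u < q ] ν u                         ≡⟨ cong ℤ.suc (sum-cong-≗ {q} λ u → ∑-select (u ^ᶠ k) λ _ → ν u) ⟨
      1ℤ + ∑[ u < q ] ∑[ x < q ] (⟦ u ^ᶠ k ≟ x ⟧ * ν u)
        ≡⟨ cong ℤ.suc (∑-comm {q} {q} λ u x → ⟦ u ^ᶠ k ≟ x ⟧ * ν u) ⟩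
      1ℤ + ∑[ x < q ] ∑[ u < q ] (⟦ u ^ᶠ k ≟ x ⟧ * ν u)
        ≤⟨ ℤₚ.+-monoʳ-≤ 1ℤ (∑-mono {q} fibre) ⟩
      1ℤ + ∑[ x < q ] (η x * + k)                 ≡⟨ cong ℤ.suc (*-distribʳ-sum {q} (+ k) η) ⟨
      1ℤ + M * + k                                ∎
      where
      open ℤₚ.≤-Reasoning
      ν : Fin q → ℤ
      ν u = ⟦ ¬? (0ᶠ ≟ u) ⟧
      split : ∀ u → 1ℤ ≡ ⟦ 0ᶠ ≟ u ⟧ + ν u
      split u with 0ᶠ ≟ u
      ... | yes _ = refl
      ... | no _  = refl
      bound : ∀ x (p? : Dec (x ≢ 0ᶠ × IsPower x)) → ∑[ u < q ] (⟦ u ^ᶠ k ≟ x ⟧ * ν u) ≤ ⟦ p? ⟧ * + k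
      bound x (yes _) = begin
        ∑[ u < q ] (⟦ u ^ᶠ k ≟ x ⟧ * ν u) ≤⟨ ∑-mono {q} (λ u → ⟦⟧*⟦⟧≤ (u ^ᶠ k ≟ x) (¬? (0ᶠ ≟ u))) ⟩
        ∑[ u < q ] ⟦ u ^ᶠ k ≟ x ⟧         ≤⟨ power-roots k x ⟩
        + k                               ≡⟨ ℤₚ.*-identityˡ (+ k) ⟨
        1ℤ * + k                          ∎
      -- A nonzero `u` has a nonzero power, so no such `u` lies over this `x`.
      bound x (no ¬p) = ≤-reflexive (∑-zero {q} λ u → ⟦⟧*⟦⟧≡0 (u ^ᶠ k ≟ x) (¬? (0ᶠ ≟ u))
        λ { refl 0≢u → ¬p (^-nonZero u k (0≢u ∘ sym) , u , refl) })
      fibre : ∀ x → ∑[ u < q ] (⟦ u ^ᶠ k ≟ x ⟧ * ν u) ≤ η x * + k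
      fibre x = bound x (nonZeroPower? x)

    -- Moments of the balanced indicator.

    ∑g≡0 : ∑[ x < q ] g x ≡ 0ℤ
    ∑g≡0 = begin
      ∑[ x < q ] (+ q * χ x + - N)                  ≡⟨ ∑-distrib-+ {q} _ _ ⟩
      ∑[ x < q ] (+ q * χ x) + ∑[ x < q ] (- N)     ≡⟨ cong₂ _+_ (sym (*-distribˡ-sum {q} (+ q) χ)) (∑-const q (- N)) ⟩
      + q * N + + q * - N                           ≡⟨ cancel (+ q) N ⟩
      0ℤ                                            ∎
      where
      open ≡-Reasoning
      cancel : ∀ a b → a * b + a * - b ≡ 0ℤ
      cancel = solve-∀

    ∑g² : ∑[ x < q ] (g x * g x) ≡ + q * N * (+ q - N)
    ∑g² = begin
      ∑[ x < q ] (g x * g x)                        ≡⟨ sum-cong-≗ {q} expand ⟩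
      ∑[ x < q ] (c * χ x + N * N)                  ≡⟨ ∑-distrib-+ {q} _ _ ⟩
      ∑[ x < q ] (c * χ x) + ∑[ x < q ] (N * N)     ≡⟨ cong₂ _+_ (sym (*-distribˡ-sum {q} c χ)) (∑-const q (N * N)) ⟩
      c * N + + q * (N * N)                         ≡⟨ collect (+ q) N ⟩
      + q * N * (+ q - N)                           ∎
      where
      open ≡-Reasoning
      -- Since `χ` is idempotent, the square of `g` is affine in `χ`; `c` is the slope.
      c = + q * + q - + 2 * (+ q * N)
      product : ∀ a x b → (a * x + - b) * (a * x + - b) ≡ a * a * (x * x) - + 2 * (a * b) * x + b * b
      product = solve-∀
      factor : ∀ a x b → a * a * x - + 2 * (a * b) * x + b * b ≡ (a * a - + 2 * (a * b)) * x + b * b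
      factor = solve-∀
      collect : ∀ a b → (a * a - + 2 * (a * b)) * b + a * (b * b) ≡ a * b * (a - b)
      collect = solve-∀
      expand : ∀ x → g x * g x ≡ c * χ x + N * N
      expand x = begin
        g x * g x                                                        ≡⟨ product (+ q) (χ x) N ⟩
        + q * + q * (χ x * χ x) - + 2 * (+ q * N) * χ x + N * N
          ≡⟨ cong (λ e → + q * + q * e - + 2 * (+ q * N) * χ x + N * N) (⟦⟧-idem (power? x)) ⟩
        + q * + q * χ x - + 2 * (+ q * N) * χ x + N * N                  ≡⟨ factor (+ q) (χ x) N ⟩
        c * χ x + N * N                                                  ∎

    -- Adding `t ⊗ ⊝ y` to `x ⊕ t ⊗ y` gives `x`. The sum therefore runs over all ways of writing
    -- `x` as `u ⊕ t ⊗ v`, with weight `g u * g v`.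
    T : Fin q → Fin q → ℤ
    T t x = ∑[ y < q ] (g (x ⊕ t ⊗ y) * g (⊝ y))

    ∑T² : ∑[ t < q ] ∑[ x < q ] (T t x * T t x) ≡ + q * (+ q * N * (+ q - N)) * (+ q * N * (+ q - N))
    ∑T² = trans (second-moment g ∑g≡0 (g ∘ ⊝_))
      (cong₂ (λ a b → + q * a * b) ∑g² (trans (∑-negate λ y → g y * g y) ∑g²))

    C : ℤ
    C = + q * (N * N)

    -- Disjointness removes the term in `χ * χ` from every product. Of the rest, the multiple of `g`
    -- sums to zero and `χ (x ⊕ t ⊗ y)` sums to `N`, because `t ≢ 0ᶠ` makes `y ↦ x ⊕ t ⊗ y` a
    -- permutation.
    T-disjoint : ∀ t x → t ≢ 0ᶠ → (∀ y → IsPower (x ⊕ t ⊗ y) → ¬ IsPower (⊝ y)) → T t x ≡ - C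
    T-disjoint t x t≢0 disjoint = begin
      ∑[ y < q ] (g (x ⊕ t ⊗ y) * g (⊝ y))
        ≡⟨ sum-cong-≗ {q} expand ⟩
      ∑[ y < q ] (c * χ (x ⊕ t ⊗ y) + - N * g (⊝ y))
        ≡⟨ ∑-distrib-+ {q} _ _ ⟩
      ∑[ y < q ] (c * χ (x ⊕ t ⊗ y)) + ∑[ y < q ] (- N * g (⊝ y))
        ≡⟨ cong₂ _+_ (*-distribˡ-sum {q} c (λ y → χ (x ⊕ t ⊗ y))) (*-distribˡ-sum {q} (- N) (g ∘ ⊝_)) ⟨
      c * ∑[ y < q ] χ (x ⊕ t ⊗ y) + - N * ∑[ y < q ] g (⊝ y)
        ≡⟨ cong₂ (λ a b → c * a + - N * b) ∑χ (trans (∑-negate g) ∑g≡0) ⟩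
      c * N + - N * 0ℤ
        ≡⟨ collect (+ q) N ⟩
      - C ∎
      where
      open ≡-Reasoning
      c = - (+ q * N)
      ∑χ : ∑[ y < q ] χ (x ⊕ t ⊗ y) ≡ N
      ∑χ = trans (sum-cong-≗ {q} λ y → cong (λ z → χ (x ⊕ z)) (*-comm t y)) (∑-affine χ x t t≢0)
      product : ∀ a b u v → (a * u + - b) * (a * v + - b) ≡ a * a * (u * v) + (- (a * b) * u + - b * (a * v + - b))
      product = solve-∀
      vanish : ∀ a e → a * a * 0ℤ + e ≡ e
      vanish = solve-∀
      collect : ∀ a b → - (a * b) * b + - b * 0ℤ ≡ - (a * (b * b))
      collect = solve-∀
      expand : ∀ y → g (x ⊕ t ⊗ y) * g (⊝ y) ≡ c * χ (x ⊕ t ⊗ y) + - N * g (⊝ y)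
      expand y = begin
        g (x ⊕ t ⊗ y) * g (⊝ y)
          ≡⟨ product (+ q) N (χ (x ⊕ t ⊗ y)) (χ (⊝ y)) ⟩
        + q * + q * (χ (x ⊕ t ⊗ y) * χ (⊝ y)) + rest
          ≡⟨ cong (λ e → + q * + q * e + rest) (⟦⟧*⟦⟧≡0 (power? (x ⊕ t ⊗ y)) (power? (⊝ y)) (disjoint y)) ⟩
        + q * + q * 0ℤ + rest
          ≡⟨ vanish (+ q) rest ⟩
        rest ∎
        where rest = c * χ (x ⊕ t ⊗ y) + - N * g (⊝ y)

    -- Elements that are not sums of two powers.

    SumOfTwoPowers : Fin q → Set
    SumOfTwoPowers a = ∃[ x ] ∃[ y ] a ≡ x ^ᶠ k ⊕ y ^ᶠ k

    -- With `s`, `t`, `s ⊗ a ⊕ t ⊗ y` and `⊝ y` the `k`-th powers of `σ`, `τ`, `v` and `w`, we have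
    -- `σ^k a = v^k + τ^k w^k`. Multiplying by the `k`-th power of `e`, the inverse of `σ`, writes
    -- `a` as a sum of two powers.
    rescale : ∀ a s t y → s ≢ 0ᶠ → IsPower s → IsPower t →
      IsPower (s ⊗ a ⊕ t ⊗ y) → IsPower (⊝ y) → SumOfTwoPowers a
    rescale a _ _ y s≢0 (σ , refl) (τ , refl) (v , v^k≡) (w , w^k≡) = e ⊗ v , e ⊗ (τ ⊗ w) , (begin
      a                                                   ≡⟨ *-identityˡ a ⟨
      1ᶠ ⊗ a                                              ≡⟨ cong (_⊗ a) ek-inverse ⟨
      e ^ᶠ k ⊗ σ ^ᶠ k ⊗ a                                 ≡⟨ *-assoc _ _ _ ⟩
      e ^ᶠ k ⊗ (σ ^ᶠ k ⊗ a)                               ≡⟨ cong (e ^ᶠ k ⊗_) sa≡ ⟩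
      e ^ᶠ k ⊗ (v ^ᶠ k ⊕ τ ^ᶠ k ⊗ w ^ᶠ k)                 ≡⟨ distribˡ _ _ _ ⟩
      e ^ᶠ k ⊗ v ^ᶠ k ⊕ e ^ᶠ k ⊗ (τ ^ᶠ k ⊗ w ^ᶠ k)        ≡⟨ cong₂ _⊕_ (^-distrib-* e v k)
        (trans (^-distrib-* e (τ ⊗ w) k) (cong (e ^ᶠ k ⊗_) (^-distrib-* τ w k))) ⟨
      (e ⊗ v) ^ᶠ k ⊕ (e ⊗ (τ ⊗ w)) ^ᶠ k                   ∎)
      where
      open ≡-Reasoning
      σ≢0 : σ ≢ 0ᶠ
      σ≢0 refl = s≢0 (0^k≡0 k)
      e = proj₁ (invert σ σ≢0)
      1^k≡1 : ∀ n → 1ᶠ ^ᶠ n ≡ 1ᶠ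
      1^k≡1 ℕ.zero    = refl
      1^k≡1 (ℕ.suc n) = trans (*-identityˡ _) (1^k≡1 n)
      ek-inverse : e ^ᶠ k ⊗ σ ^ᶠ k ≡ 1ᶠ
      ek-inverse = begin
        e ^ᶠ k ⊗ σ ^ᶠ k ≡⟨ ^-distrib-* e σ k ⟨
        (e ⊗ σ) ^ᶠ k    ≡⟨ cong (_^ᶠ k) (trans (*-comm e σ) (proj₂ (invert σ σ≢0))) ⟩
        1ᶠ ^ᶠ k         ≡⟨ 1^k≡1 k ⟩
        1ᶠ              ∎
      sa≡ : σ ^ᶠ k ⊗ a ≡ v ^ᶠ k ⊕ τ ^ᶠ k ⊗ w ^ᶠ k
      sa≡ = begin
        σ ^ᶠ k ⊗ a                                      ≡⟨ //-rightDividesʳ (τ ^ᶠ k ⊗ y) (σ ^ᶠ k ⊗ a) ⟨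
        σ ^ᶠ k ⊗ a ⊕ τ ^ᶠ k ⊗ y ⊕ ⊝ (τ ^ᶠ k ⊗ y)        ≡⟨ cong₂ _⊕_ (sym v^k≡) (-‿distribʳ-* (τ ^ᶠ k) y) ⟩
        v ^ᶠ k ⊕ τ ^ᶠ k ⊗ ⊝ y                           ≡⟨ cong (λ z → v ^ᶠ k ⊕ τ ^ᶠ k ⊗ z) w^k≡ ⟨
        v ^ᶠ k ⊕ τ ^ᶠ k ⊗ w ^ᶠ k                        ∎

    module _ (a : Fin q) (a≢0 : a ≢ 0ᶠ) (¬sum : ¬ SumOfTwoPowers a) where

      -- If `t` and `s` are both nonzero powers, `rescale` rules out any overlap and `T-disjoint`
      -- gives the exact value `- C`. Otherwise the left side is zero and the right side is a
      -- square. The summand `0ᶠ` gives the argument the shape that `∑-affine` expects.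
      pointwise : ∀ t s → η t * η s * (C * C) ≤ T t (0ᶠ ⊕ s ⊗ a) * T t (0ᶠ ⊕ s ⊗ a)
      pointwise t s = bound (nonZeroPower? t) (nonZeroPower? s)
        where
        T² = T t (0ᶠ ⊕ s ⊗ a) * T t (0ᶠ ⊕ s ⊗ a)
        0≤T² = 0≤i*i (T t (0ᶠ ⊕ s ⊗ a))
        one-square : ∀ c → 1ℤ * (c * c) ≡ - c * - c
        one-square = solve-∀
        T≡-C : t ≢ 0ᶠ × IsPower t → s ≢ 0ᶠ × IsPower s → T t (0ᶠ ⊕ s ⊗ a) ≡ - C
        T≡-C (t≢0 , tPower) (s≢0 , sPower) = trans (cong (T t) (+-identityˡ (s ⊗ a)))
          (T-disjoint t (s ⊗ a) t≢0 λ y p p′ → ¬sum (rescale a s t y s≢0 sPower tPower p p′))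
        bound : (t? : Dec (t ≢ 0ᶠ × IsPower t)) (s? : Dec (s ≢ 0ᶠ × IsPower s)) →
          ⟦ t? ⟧ * ⟦ s? ⟧ * (C * C) ≤ T²
        bound (no _)   s?       = 0≤T²
        bound (yes _)  (no _)   = 0≤T²
        bound (yes tp) (yes sp) = ≤-reflexive (trans (one-square C) (sym (cong (λ z → z * z) (T≡-C tp sp))))

      -- Sum `pointwise` over all pairs; as `a ≢ 0ᶠ`, the multiples `s ⊗ a` run once through the
      -- field, so the sum over `s` becomes the sum over `x`.
      lower-bound : M * M * (C * C) ≤ ∑[ t < q ] ∑[ x < q ] (T t x * T t x)
      lower-bound = begin
        M * M * (C * C)
          ≡⟨ cong (_* (C * C)) (sum-squared {q} η) ⟩
        ∑[ t < q ] ∑[ s < q ] (η t * η s) * (C * C)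
          ≡⟨ *-distribʳ-sum {q} (C * C) (λ t → ∑[ s < q ] (η t * η s)) ⟩
        ∑[ t < q ] (∑[ s < q ] (η t * η s) * (C * C))
          ≡⟨ sum-cong-≗ {q} (λ t → *-distribʳ-sum {q} (C * C) (λ s → η t * η s)) ⟩
        ∑[ t < q ] ∑[ s < q ] (η t * η s * (C * C))
          ≤⟨ ∑-mono {q} (λ t → ∑-mono {q} λ s → pointwise t s) ⟩
        ∑[ t < q ] ∑[ s < q ] (T t (0ᶠ ⊕ s ⊗ a) * T t (0ᶠ ⊕ s ⊗ a))
          ≡⟨ sum-cong-≗ {q} (λ t → ∑-affine (λ x → T t x * T t x) 0ᶠ a a≢0) ⟩
        ∑[ t < q ] ∑[ x < q ] (T t x * T t x) ∎
        where open ℤₚ.≤-Reasoning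

      order-bound : q ℕ.≤ k ^ 4
      -- `R` is the number of non-powers. `N` is rewritten as `1ℤ + M` because the arithmetic is
      -- parametrised by the number of nonzero powers.
      order-bound = q≤k⁴-ℤ k q M (+ q - N) 0≤M (ℤₚ.i≤j⇒0≤j-i N≤q)
        (subst (λ n → + q ≡ n + (+ q - N)) N≡1+M (add-sub (+ q) N)) q≤1+Mk
        (subst (λ n → M * M * ((+ q * (n * n)) * (+ q * (n * n)))
                    ≤ + q * (+ q * n * (+ q - N)) * (+ q * n * (+ q - N)))
          N≡1+M (≤-trans lower-bound (≤-reflexive ∑T²)))
        where
        add-sub : ∀ a b → a ≡ b + (a - b)
        add-sub = solve-∀

    sumOfTwoPowers : q > k ^ 4 → ∀ a → SumOfTwoPowers a
    sumOfTwoPowers q>k⁴ a with a ≟ 0ᶠ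
    ... | yes refl = 0ᶠ , 0ᶠ , sym (trans (cong₂ _⊕_ (0^k≡0 k) (0^k≡0 k)) (+-identityˡ 0ᶠ))
    -- The search over pairs is finite, so arguing by contradiction is constructive here.
    ... | no a≢0 with any? (λ x → any? λ y → a ≟ x ^ᶠ k ⊕ y ^ᶠ k)
    ...   | yes sum = sum
    ...   | no ¬sum = contradiction (order-bound a a≢0 ¬sum) (ℕₚ.<⇒≱ q>k⁴)

-- Transport between a Heyting field of order `q` and `Fin q`.

module _ {c ℓ₁ ℓ₂ : Level} {q : ℕ} (F : HeytingField c ℓ₁ ℓ₂) (order : HasOrder F q) where

  private
    module F = HeytingField F
    open Inverse order

    R′ : CommutativeRing c ℓ₁
    R′ = HeytingCommutativeRing.commutativeRing F.heytingCommutativeRing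
    open Exp (CommutativeRing.semiring R′) using () renaming (_^_ to _^′_)

    from-to : ∀ x → from (to x) F.≈ x
    from-to = strictlyInverseʳ

    finRawRing : RawRing 0ℓ 0ℓ
    finRawRing = record
      { Carrier = Fin q
      ; _≈_     = _≡_
      ; _+_     = λ i j → to (from i F.+ from j)
      ; _*_     = λ i j → to (from i F.* from j)
      ; -_      = λ i → to (F.- from i)
      ; 0#      = to F.0#
      ; 1#      = to F.1#
      }

    from-injective : ∀ {i j} → from i F.≈ from j → i ≡ j
    from-injective {i} {j} eq = trans (sym (strictlyInverseˡ i)) (trans (to-cong eq) (strictlyInverseˡ j))

    -- The operations on `Fin q` are conjugated by the bijection, so `from` preserves them up to
    -- `_≈_`; being injective, it pulls the commutative ring laws back to `Fin q`.
    from-isRingMonomorphism : IsRingMonomorphism finRawRing (CommutativeRing.rawRing R′) from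
    from-isRingMonomorphism = record
      { isRingHomomorphism = record
        { isSemiringHomomorphism = record
          { isNearSemiringHomomorphism = record
            { +-isMonoidHomomorphism = record
              { isMagmaHomomorphism = record
                { isRelHomomorphism = record { cong = from-cong }
                ; homo = λ i j → from-to (from i F.+ from j)
                }
              ; ε-homo = from-to F.0#
              }
            ; *-homo = λ i j → from-to (from i F.* from j)
            }
          ; 1#-homo = from-to F.1#
          }
        ; -‿homo = λ i → from-to (F.- from i)
        }
      ; injective = from-injective
      }

  1≉0 : ¬ F.1# F.≈ F.0#
  1≉0 1≈0 = proj₂ (F.tight F.1# F.0#) 1≈0 (HeytingProperties.1#0 F.heytingCommutativeRing)

  -- Since the search for an inverse terminates, tightness turns x ≉ 0# into invertibility.
  invertible : ∀ i → i ≢ to F.0# → ∃[ j ] to (from i F.* from j) ≡ to F.1#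
  invertible i i≢0 with any? (λ j → to (from i F.* from j) ≟ to F.1#)
  ... | yes inverse = inverse
  ... | no ¬inverse = contradiction (from-injective (F.trans from-i≈0 (F.sym (from-to F.0#)))) i≢0
    where
    ¬apart : ¬ from i F.# F.0#
    ¬apart apart with y , _ , x-0*y≈1 ← F.#⇒invertible apart = ¬inverse (to y , to-cong
      (F.trans (F.*-cong (F.sym (HeytingProperties.x-0≈x F.heytingCommutativeRing (from i))) (from-to y))
        x-0*y≈1))
    from-i≈0 : from i F.≈ F.0#
    from-i≈0 = proj₁ (F.tight (from i) F.0#) ¬apart

  finiteField : FiniteField q
  finiteField = record
    { isCommutativeRing = RingMonomorphism.isCommutativeRing from-isRingMonomorphism F.isCommutativeRing
    ; 1≢0 = λ eq → 1≉0 (F.trans (F.sym (from-to F.1#)) (F.trans (from-cong eq) (from-to F.0#)))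
    ; invert = invertible
    }

  from-^ : ∀ i k → from (FiniteField._^ᶠ_ finiteField i k) F.≈ from i ^′ k
  from-^ i ℕ.zero    = from-to F.1#
  from-^ i (ℕ.suc k) = F.trans (from-to _) (F.*-cong F.refl (from-^ i k))

theorem3p2 : {c ℓ₁ ℓ₂ : Level} (k q : ℕ) .{{_ : NonZero k}} (F : HeytingField c ℓ₁ ℓ₂) →
    HasOrder F q →
    q > k ^ 4 →
    (a : HeytingField.Carrier F) → IsSumOfTwoPowers F k a
theorem3p2 k q F order q>k⁴ a
  with x , y , a≡x^k+y^k ← sumOfTwoPowers (finiteField F order) k q>k⁴ (Inverse.to order a)
  = from x , from y , (begin
    a                                           ≈⟨ strictlyInverseʳ a ⟨
    from (to a)                                 ≈⟨ from-cong a≡x^k+y^k ⟩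
    from (x ^ᶠ k ⊕ y ^ᶠ k)                      ≈⟨ strictlyInverseʳ _ ⟩
    from (x ^ᶠ k) F.+ from (y ^ᶠ k)             ≈⟨ F.+-cong (from-^ F order x k) (from-^ F order y k) ⟩
    _                                           ∎)
  where
  module F = HeytingField F
  open Inverse order
  open FiniteField (finiteField F order) using (_⊕_; _^ᶠ_)
  open ≈-Reasoning (CommutativeRing.setoid (HeytingCommutativeRing.commutativeRing F.heytingCommutativeRing))
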